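{- Let $m\ge 2$, let $h_\omega$ be the infinite $m$-bonacci word and let $(z_n)_{n\ge 0}=(z_n^{(m)})_{n\ge 0}$ be the sequence of words defined in the context. The closed $z$-factorization of $h_\omega$ is $$cz(h_\omega)=(z_0,\,z_1,\,z_2,\,z_3,\,\ldots).$$
   Context: Fix $m\ge 2$ and $A_m=\{0,1,\ldots,m-1\}$. The morphism $\varphi_m:A_m^*\to A_m^*$ is given by $\varphi_m(i)=0(i+1)$ for $0\le i\le m-2$ and $\varphi_m(m-1)=0$. Put $h_n=\varphi_m^n(0)$ for $n\ge 0$; the infinite $m$-bonacci word $h_\omega$ is the fixed point of $\varphi_m$ starting with $0$. $w^R$ is the reversal of a word $w$. If $w=uv$ then $u^{ -1}w=v$ and $wv^{ -1}=u$. For an integer $n$, $\underline{n}$ is the letter $n \bmod m\in\{0,\ldots,m-1\}$. The words $z_n$: $z_0=0$, $z_1=1$; $z_2=020$ if $m\ge 3$ and $z_2=00$ if $m=2$. If $m=2$, then for $n\ge 3$, $z_n=(\underline{n-3})^{ -1}h_{n-3}^R\,h_{n-2}^R\,\underline{n-2}$. If $m\ge 3$, then for $3\le n\le m-1$, $$z_n=(n-3)^{ -1}h_{n-3}^R\,h_{n-2}^R\,n\,h_0^Rh_1^R\cdots h_{n-3}^R\,(n-2)$$ (where $n$, $n-2$, $n-3$ denote letters), and for $n\ge \max(3,m)$, $$z_n=(\underline{n-3})^{ -1}h_{n-3}^R\,h_{n-2}^R\,h_{n-m}^Rh_{n-m+1}^R\cdots h_{n-3}^R\,\underline{n-2}.$$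 A word $x$ is a border of $w$ if it is nonempty and both a prefix and a suffix of $w$. A nonempty finite word $w$ is closed if it is a single letter or it has a border $x$ that occurs exactly twice in $w$ (occurrences may overlap). The closed $z$-factorization of an infinite word $\boldsymbol w$ is the factorization $cz(\boldsymbol w)=(y_0,y_1,\ldots)$ with $\boldsymbol w=y_0y_1\cdots$, where for each $i$, $y_i$ is the shortest closed prefix of $y_iy_{i+1}\cdots$ that occurs exactly once in $y_0y_1\cdots y_i$. -}

module Defs where

open import Data.Bool.Base using (if_then_else_; true; false)
open import Data.Fin.Base using (Fin; zero; suc; toℕ; fromℕ<; cast)
open import Data.Fin.Properties using (toℕ-fromℕ<; toℕ-injective; toℕ<n; toℕ-cast; cast-is-id)
  renaming (_≟_ to _≟ᶠ_)
open import Data.List.Base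
  using (List; []; _∷_; [_]; _++_; length; lookup; map; concat; concatMap; reverse; upTo; applyUpTo)
open import Data.List.Properties
  using (length-++-≤ˡ; length-++-≤ʳ; ++-assoc; ++-identityʳ; concatMap-++; reverse-++)
open import Data.List.Relation.Binary.Prefix.Heterogeneous using (Prefix)
open import Data.List.Relation.Binary.Suffix.Heterogeneous using (Suffix)
open import Data.Nat.Base
open import Data.Nat.DivMod
  using (_mod_; m%n<n; m%n%n≡m%n; m<n⇒m%n≡m; n%n≡0; %-distribˡ-+)
open import Data.Nat.Properties
  using (≤-trans; ≤-antisym; <-trans; <-≤-trans; <⇒≤; ≮⇒≥; +-comm; suc-injective; <ᵇ-reflects-<)
open import Data.Product.Base using (_×_; _,_; ∃-syntax; ∃₂; Σ-syntax; proj₂)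
open import Data.Sum.Base using (_⊎_)
open import Relation.Binary.PropositionalEquality hiding ([_])
open import Relation.Nullary.Decidable.Core using (does; yes; no)
open import Relation.Nullary.Negation.Core using (contradiction)
open import Relation.Nullary.Reflects using (ofⁿ)

------------------------------------------------------------------------
-- Finite and infinite words, closed z-factorizations

module _ {A : Set} where

  OccursAt : List A → List A → ℕ → Set
  OccursAt x w i = ∃₂ λ u v → w ≡ u ++ x ++ v × length u ≡ i

  OccursOnce : List A → List A → Set
  OccursOnce x w = ∃[ i ] OccursAt x w i × (∀ k → OccursAt x w k → k ≡ i)

  OccursTwice : List A → List A → Set
  OccursTwice x w = ∃₂ λ i j →
    i < j × OccursAt x w i × OccursAt x w j × (∀ k → OccursAt x w k → k ≡ i ⊎ k ≡ j)

  Border : List A → List A → Set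
  Border x w = x ≢ [] × Prefix _≡_ x w × Suffix _≡_ x w

  Closed : List A → Set
  Closed w = w ≢ [] × (length w ≡ 1 ⊎ (∃[ x ] Border x w × OccursTwice x w))

  ωWord : Set
  ωWord = ℕ → A

  infix 4 _⊑_

  -- u is a prefix of the infinite word w
  _⊑_ : List A → ωWord → Set
  u ⊑ w = ∀ i → lookup u i ≡ w (toℕ i)

  dropω : ℕ → ωWord → ωWord
  dropω n w k = w (n + k)

  -- partialProduct y n = y₀ y₁ ⋯ yₙ₋₁
  partialProduct : (ℕ → List A) → ℕ → List A
  partialProduct y n = concat (applyUpTo y n)

  -- w = y₀ y₁ y₂ ⋯; the second component makes the product infinite.
  IsProduct : ωWord → (ℕ → List A) → Set
  IsProduct w y =
    (∀ n → partialProduct y n ⊑ w) × (∀ N → ∃[ n ] N ≤ length (partialProduct y n))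

  -- x may be chosen as the factor following the factors whose product is p.
  -- For a shorter competitor x of the factor yᵢ, occurrences are counted in
  -- y₀ ⋯ yᵢ₋₁ x, i.e. with x in place of yᵢ.
  Candidate : ωWord → List A → List A → Set
  Candidate w p x = x ⊑ dropω (length p) w × Closed x × OccursOnce x (p ++ x)

  record IsClosedZFactorization (w : ωWord) (y : ℕ → List A) : Set where
    field
      product   : IsProduct w y
      candidate : ∀ i → Candidate w (partialProduct y i) (y i)
      shortest  : ∀ i x → Candidate w (partialProduct y i) x → length (y i) ≤ length x

------------------------------------------------------------------------
-- The m-bonacci word and the words zₙ

module _ (m : ℕ) .{{_ : NonTrivial m}} where

  Word : Set
  Word = List (Fin m)

  letter : ℕ → Fin m
  letter n = _mod_ n m {{nonTrivial⇒nonZero m}}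

  φ : Fin m → Word
  φ i = letter 0 ∷ (if suc (toℕ i) <ᵇ m then [ letter (suc (toℕ i)) ] else [])

  φ* : Word → Word
  φ* = concatMap φ

  h : ℕ → Word
  h zero    = [ letter 0 ]
  h (suc n) = φ* (h n)

  -- Since φ* is non-erasing, this says φ(w) = w for the infinite word w.
  IsFixedPoint : ωWord → Set
  IsFixedPoint w = ∀ u → u ⊑ w → φ* u ⊑ w

  1<m : 1 < m
  1<m = nonTrivial⇒n>1 m

  toℕ-letter : ∀ n → toℕ (letter n) ≡ _%_ n m {{nonTrivial⇒nonZero m}}
  toℕ-letter n = toℕ-fromℕ< (m%n<n n m {{nonTrivial⇒nonZero m}})

  toℕ-letter-0 : toℕ (letter 0) ≡ 0
  toℕ-letter-0 = trans (toℕ-letter 0)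
    (m<n⇒m%n≡m {{nonTrivial⇒nonZero m}} (<-trans z<s 1<m))

  φ-0 : φ (letter 0) ≡ letter 0 ∷ letter 1 ∷ []
  φ-0 rewrite toℕ-letter-0 with 1 <ᵇ m | <ᵇ-reflects-< 1 m
  ... | true  | _        = refl
  ... | false | ofⁿ 1≮m = contradiction 1<m 1≮m

  length-φ* : ∀ u → length u ≤ length (φ* u)
  length-φ* []      = z≤n
  length-φ* (i ∷ u) = s≤s (≤-trans (length-φ* u) (length-++-≤ʳ (φ* u) {if suc (toℕ i) <ᵇ m then [ letter (suc (toℕ i)) ] else []}))

  h-grows : ∀ n → ∃[ u ] h n ≡ letter 0 ∷ u × n ≤ length u
  h-grows zero    = [] , refl , z≤n
  h-grows (suc n) with u , eq , n≤ ← h-grows n =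
    letter 1 ∷ φ* u , trans (cong φ* eq) (cong (_++ φ* u) φ-0) , s≤s (≤-trans n≤ (length-φ* u))

  n<length-h : ∀ n → n < length (h n)
  n<length-h n with u , eq , n≤ ← h-grows n =
    subst (n <_) (sym (cong length eq)) (s≤s n≤)

  -- Each hₙ is a prefix of hₙ₊₁; hω is their limit.
  hω : ωWord
  hω n = lookup (h n) (fromℕ< (n<length-h n))

  h-step : ∀ n → ∃[ v ] h (suc n) ≡ h n ++ v
  h-step zero    = [ letter 1 ] , trans (++-identityʳ _) φ-0
  h-step (suc n) with v , eq ← h-step n = φ* v , trans (cong φ* eq) (concatMap-++ φ (h n) v)

  h-mono : ∀ k n → ∃[ v ] h (k + n) ≡ h n ++ v
  h-mono zero    n = [] , sym (++-identityʳ _)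
  h-mono (suc k) n with v , eq ← h-mono k n | v′ , eq′ ← h-step (k + n) =
    v ++ v′ , trans eq′ (trans (cong (_++ v′) eq) (++-assoc (h n) v v′))

  lookup-++ : ∀ (u v : Word) i j → toℕ i ≡ toℕ j → lookup u i ≡ lookup (u ++ v) j
  lookup-++ (a ∷ u) v zero    zero    _  = refl
  lookup-++ (a ∷ u) v (suc i) (suc j) eq = lookup-++ u v i j (suc-injective eq)

  extend : ∀ (u v : Word) i → Σ[ j ∈ Fin (length (u ++ v)) ] toℕ i ≡ toℕ j
  extend u v i = fromℕ< i<′ , sym (toℕ-fromℕ< i<′)
    where i<′ = <-≤-trans (toℕ<n {length u} i) (length-++-≤ˡ u)

  ⊑-++⁻ : ∀ w (u v : Word) → u ++ v ⊑ w → u ⊑ w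
  ⊑-++⁻ w u v p i with j , eq ← extend u v i =
    trans (lookup-++ u v i j eq) (trans (p j) (cong w (sym eq)))

  ⊑-≤ : ∀ w (u x : Word) → u ⊑ w → x ⊑ w → length u ≤ length x → ∃[ v ] x ≡ u ++ v
  ⊑-≤ w []      x       _ _ _       = x , refl
  ⊑-≤ w (a ∷ u) (b ∷ x) p q (s≤s l) with v , eq ← ⊑-≤ (λ k → w (suc k)) u x (λ i → p (suc i)) (λ i → q (suc i)) l =
    v , cong₂ _∷_ (trans (q zero) (sym (p zero))) eq

  h⊑hω : ∀ n → h n ⊑ hω
  h⊑hω n i with v , eq ← h-mono (toℕ i) n | v′ , eq′ ← h-mono n (toℕ i) =
    agree (trans (sym eq) (trans (cong h (+-comm (toℕ i) n)) eq′))
    where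
    agree : h n ++ v ≡ h (toℕ i) ++ v′ → lookup (h n) i ≡ hω (toℕ i)
    agree e with j , p ← extend (h n) v i =
      trans (lookup-++ (h n) v i j p) (trans (transport e j) (sym
        (lookup-++ (h (toℕ i)) v′ _ _
          (trans (toℕ-fromℕ< (n<length-h (toℕ i))) (trans p (sym (toℕ-cast (cong length e) j)))))))
      where
      transport : ∀ {a b : Word} (e : a ≡ b) j → lookup a j ≡ lookup b (cast (cong length e) j)
      transport {a} refl j = cong (lookup a) (sym (cast-is-id refl j))

  hω-0 : hω 0 ≡ letter 0
  hω-0 = refl

  hω-isFixedPoint : IsFixedPoint hω
  hω-isFixedPoint u u⊑
    with v , eq ← ⊑-≤ hω u (h (length u)) u⊑ (h⊑hω (length u)) (<⇒≤ (n<length-h (length u))) =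
    ⊑-++⁻ hω (φ* u) (φ* v)
      (subst (_⊑ hω) (trans (cong φ* eq) (concatMap-++ φ u v)) (h⊑hω (suc (length u))))

  hω-unique : ∀ w → w 0 ≡ letter 0 → IsFixedPoint w → ∀ n → w n ≡ hω n
  hω-unique w w0 fix n =
    sym (trans (h⊑w n (fromℕ< (n<length-h n))) (cong w (toℕ-fromℕ< (n<length-h n))))
    where
    h⊑w : ∀ n → h n ⊑ w
    h⊑w zero    zero = sym w0
    h⊑w (suc n) = fix (h n) (h⊑w n)

  -- a ⁻¹∙ w is the word v with w = a v; its value is junk if w does not start
  -- with a, which by z-quotient never happens in the definition of z.
  infixr 4 _⁻¹∙_

  _⁻¹∙_ : Fin m → Word → Word
  a ⁻¹∙ []      = []
  a ⁻¹∙ (b ∷ w) = if does (a ≟ᶠ b) then w else []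

  -- hᴿ⟨ a ⋯ b ⟩ = h_aᴿ h_{a+1}ᴿ ⋯ h_bᴿ
  hᴿ⟨_⋯_⟩ : ℕ → ℕ → Word
  hᴿ⟨ a ⋯ b ⟩ = concat (map (λ j → reverse (h (a + j))) (upTo (suc b ∸ a)))

  -- The word of which zₙ is a left quotient, for n ≥ 3.
  numerator : ℕ → Word
  numerator n =
    if m ≡ᵇ 2 then
      reverse (h (n ∸ 3)) ++ reverse (h (n ∸ 2)) ++ [ letter (n ∸ 2) ]
    else if n <ᵇ m then
      reverse (h (n ∸ 3)) ++ reverse (h (n ∸ 2)) ++ [ letter n ] ++ hᴿ⟨ 0 ⋯ n ∸ 3 ⟩ ++ [ letter (n ∸ 2) ]
    else
      reverse (h (n ∸ 3)) ++ reverse (h (n ∸ 2)) ++ hᴿ⟨ n ∸ m ⋯ n ∸ 3 ⟩ ++ [ letter (n ∸ 2) ]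

  z : ℕ → Word
  z 0 = [ letter 0 ]
  z 1 = [ letter 1 ]
  z 2 = if m ≡ᵇ 2 then letter 0 ∷ letter 0 ∷ [] else letter 0 ∷ letter 2 ∷ letter 0 ∷ []
  z n@(suc (suc (suc _))) = letter (n ∸ 3) ⁻¹∙ numerator n

  letter-suc : ∀ n → letter (suc (toℕ (letter n))) ≡ letter (suc n)
  letter-suc n = toℕ-injective (begin
    toℕ (letter (suc (toℕ (letter n))))  ≡⟨ toℕ-letter _ ⟩
    suc (toℕ (letter n)) % m             ≡⟨ cong (λ k → suc k % m) (toℕ-letter n) ⟩
    suc (n % m) % m                      ≡⟨ %-distribˡ-+ 1 (n % m) m ⟩
    (1 % m + n % m % m) % m              ≡⟨ cong (λ k → (1 % m + k) % m) (m%n%n≡m%n n m) ⟩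
    (1 % m + n % m) % m                  ≡⟨ %-distribˡ-+ 1 n m ⟨
    suc n % m                            ≡⟨ toℕ-letter _ ⟨
    toℕ (letter (suc n))                 ∎)
    where
    open ≡-Reasoning
    instance
      m≢0 : NonZero m
      m≢0 = nonTrivial⇒nonZero m

  letter-wrap : ∀ i → suc (toℕ i) ≮ m → letter 0 ≡ letter (suc (toℕ i))
  letter-wrap i ≮m = toℕ-injective (trans toℕ-letter-0 (sym (trans (toℕ-letter _)
    (trans (cong (λ k → _%_ k m {{nonTrivial⇒nonZero m}}) (≤-antisym (toℕ<n i) (≮⇒≥ ≮m)))
      (n%n≡0 m {{nonTrivial⇒nonZero m}})))))

  φ-last : ∀ n → ∃[ u ] φ (letter n) ≡ u ++ [ letter (suc n) ]
  φ-last n with suc (toℕ (letter n)) <ᵇ m | <ᵇ-reflects-< (suc (toℕ (letter n))) m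
  ... | true  | _      = [ letter 0 ] , cong (λ a → letter 0 ∷ a ∷ []) (letter-suc n)
  ... | false | ofⁿ ≮m = [] , cong [_] (trans (letter-wrap (letter n) ≮m) (letter-suc n))

  h-last : ∀ n → ∃[ u ] h n ≡ u ++ [ letter n ]
  h-last zero    = [] , refl
  h-last (suc n) with u , eq ← h-last n | v , eq′ ← φ-last n = φ* u ++ v , (begin
    φ* (h n)                          ≡⟨ cong φ* eq ⟩
    φ* (u ++ [ letter n ])            ≡⟨ concatMap-++ φ u [ letter n ] ⟩
    φ* u ++ φ (letter n) ++ []        ≡⟨ cong (φ* u ++_) (trans (++-identityʳ _) eq′) ⟩
    φ* u ++ v ++ [ letter (suc n) ]   ≡⟨ ++-assoc (φ* u) v _ ⟨
    (φ* u ++ v) ++ [ letter (suc n) ] ∎)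
    where open ≡-Reasoning

  ⁻¹∙-correct : ∀ {a v w} → w ≡ a ∷ v → w ≡ a ∷ (a ⁻¹∙ w)
  ⁻¹∙-correct {a} refl with a ≟ᶠ a
  ... | yes _  = refl
  ... | no a≢a = contradiction refl a≢a

  numerator-head : ∀ k → ∃[ v ] numerator (3 + k) ≡ letter k ∷ v
  numerator-head k with u , eq ← h-last k
    rewrite trans (cong reverse eq) (reverse-++ u [ letter k ]) with m ≡ᵇ 2 | 3 + k <ᵇ m
  ... | true  | _     = _ , refl
  ... | false | true  = _ , refl
  ... | false | false = _ , refl

  z-quotient : ∀ k → numerator (3 + k) ≡ letter k ∷ z (3 + k)
  z-quotient k = ⁻¹∙-correct (proj₂ (numerator-head k))

-- Let σ(a) = a + 1 mod m and T(xa) = φ(x) 0 σ(a).  An occurrence of T(w) in hω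
-- is the image of an occurrence of w, and likewise for T(w) without its first 0
-- when w starts with 0.  With pₙ = z₀ ⋯ zₙ₋₁ there is a word e ∈ {ε, 0} such that
-- pₙ₊₁ = φ(pₙ) e and e zₙ₊₁ = T(zₙ), so all that is needed about zₙ can be carried
-- from n to n + 1, starting at n = 2:  zₙ first occurs in hω right after pₙ; zₙ is
-- a complete return to a border Ba, a a letter; and zₙ has a prefix gB, g ≠ ε,
-- that already occurs before.  A shorter closed prefix x of zₙ cannot have a
-- border of length |Ba| or more, so its border is a prefix of B; as B recurs
-- in gB, x is then a prefix of gB and not new.

module Submission where

open import Defs
open import Data.Nat.Base using (ℕ; NonTrivial)

open import Data.Bool.Base using (Bool; true; false; if_then_else_)
open import Data.Fin.Base using (Fin; zero; suc; toℕ)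
open import Data.Fin.Properties using (toℕ-injective; toℕ<n)
open import Algebra.Definitions.RawMagma using () renaming (_,_ to quotient)
open import Data.Empty using (⊥)
open import Data.List.Relation.Binary.Prefix.Propositional.Properties using (Prefix-as-∣ˡ; ∣ˡ-as-Prefix)
open import Data.List.Relation.Binary.Suffix.Propositional.Properties using (Suffix-as-∣ʳ; ∣ʳ-as-Suffix)
open import Data.List.Base using (List; []; _∷_; [_]; _++_; _∷ʳ_; length; drop; map; concat; concatMap; reverse; upTo; applyUpTo)
open import Data.List.Properties
open import Data.Nat.Base using (zero; suc; _+_; _∸_; _≤_; _<_; _<ᵇ_; _≡ᵇ_; z≤n; s≤s; z<s; nonTrivial⇒nonZero)
open import Data.Nat.DivMod using (m<n⇒m%n≡m)
open import Data.Nat.Properties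
open import Data.Product.Base using (_×_; _,_; ∃-syntax; proj₂)
open import Data.Sum.Base using (_⊎_; inj₁; inj₂)
open import Relation.Binary.PropositionalEquality hiding ([_])
open import Relation.Nullary.Negation.Core using (contradiction)
open import Relation.Nullary.Reflects using (Reflects; ofʸ; ofⁿ)

-- Prefixes of infinite words and partial products.

module _ {A : Set} where

  ⊑-drop : ∀ (w : ωWord) (p : List A) {x} → p ++ x ⊑ w → x ⊑ dropω (length p) w
  ⊑-drop w []      q = q
  ⊑-drop w (a ∷ p) q = ⊑-drop (λ k → w (suc k)) p (λ i → q (suc i))

  ⊑-glue : ∀ (w : ωWord) (p : List A) {x} → p ⊑ w → x ⊑ dropω (length p) w → p ++ x ⊑ w
  ⊑-glue w []      _ r         = r
  ⊑-glue w (a ∷ p) q r zero    = q zero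
  ⊑-glue w (a ∷ p) q r (suc i) = ⊑-glue (λ k → w (suc k)) p (λ i → q (suc i)) r i

  +-length-≤ : ∀ (u v x : List A) → length (u ++ x) ≤ length (v ++ x) → length u ≤ length v
  +-length-≤ u v x le = +-cancelʳ-≤ (length x) _ _ (subst₂ _≤_ (length-++ u) (length-++ v) le)

  partialProduct-suc : ∀ (y : ℕ → List A) n → partialProduct y (suc n) ≡ partialProduct y n ++ y n
  partialProduct-suc y n = begin
    concat (applyUpTo y (suc n))            ≡⟨ cong concat (applyUpTo-∷ʳ y n) ⟨
    concat (applyUpTo y n ∷ʳ y n)           ≡⟨ concat-++ (applyUpTo y n) [ y n ] ⟨
    partialProduct y n ++ y n ++ []         ≡⟨ cong (partialProduct y n ++_) (++-identityʳ (y n)) ⟩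
    partialProduct y n ++ y n               ∎
    where open ≡-Reasoning

-- Letters and the blocks φ(a).

module _ (m : ℕ) .{{_ : NonTrivial m}} where

  private
    𝟎 : Fin m
    𝟎 = letter m 0

  σ : Fin m → Fin m
  σ a = letter m (suc (toℕ a))

  toℕ-σ : ∀ a → suc (toℕ a) < m → toℕ (σ a) ≡ suc (toℕ a)
  toℕ-σ a lt = trans (toℕ-letter m _)
    (m<n⇒m%n≡m {{nonTrivial⇒nonZero m}} lt)

  data φView (a : Fin m) : Set where
    inner : suc (toℕ a) < m → φ m a ≡ 𝟎 ∷ σ a ∷ [] → φView a
    last  : suc (toℕ a) ≡ m → φ m a ≡ [ 𝟎 ] → σ a ≡ 𝟎 → φView a

  φ-view : ∀ a → φView a
  φ-view a with suc (toℕ a) <ᵇ m in eq | <ᵇ-reflects-< (suc (toℕ a)) m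
  ... | true  | ofʸ lt = inner lt (aux eq)
    where
    aux : (suc (toℕ a) <ᵇ m) ≡ true → φ m a ≡ 𝟎 ∷ σ a ∷ []
    aux e rewrite e = refl
  ... | false | ofⁿ ge = last (≤-antisym (toℕ<n a) (≮⇒≥ ge)) (aux eq) (sym (letter-wrap m a ge))
    where
    aux : (suc (toℕ a) <ᵇ m) ≡ false → φ m a ≡ 𝟎 ∷ []
    aux e rewrite e = refl

  σ≢𝟎 : ∀ a → suc (toℕ a) < m → σ a ≢ 𝟎
  σ≢𝟎 a lt eq with () ← trans (sym (toℕ-σ a lt)) (trans (cong toℕ eq) (toℕ-letter-0 m))

  σ-injective : ∀ a b → σ a ≡ σ b → a ≡ b
  σ-injective a b eq with φ-view a | φ-view b
  ... | inner p _  | inner q _  = toℕ-injective (suc-injective (trans (sym (toℕ-σ a p)) (trans (cong toℕ eq) (toℕ-σ b q))))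
  ... | inner p _  | last _ _ q = contradiction (trans eq q) (σ≢𝟎 a p)
  ... | last _ _ p | inner q _  = contradiction (trans (sym eq) p) (σ≢𝟎 b q)
  ... | last p _ _ | last q _ _ = toℕ-injective (suc-injective (trans p (sym q)))

  σ-letter : ∀ n → σ (letter m n) ≡ letter m (suc n)
  σ-letter = letter-suc m

  -- What φ(a) lacks of 0 σ(a). For n > 2, the word e with pₙ₊₁ = φ(pₙ) e is the carry of the last
  -- letter of pₙ.
  carry : Fin m → Word m
  carry a with φ-view a
  ... | inner _ _  = []
  ... | last _ _ _ = [ 𝟎 ]

  φ-carry : ∀ a → φ m a ++ carry a ≡ 𝟎 ∷ σ a ∷ []
  φ-carry a with φ-view a
  ... | inner _ eq   = trans (++-identityʳ _) eq
  ... | last _ eq σ0 = trans (cong (_++ [ 𝟎 ]) eq) (cong (λ b → 𝟎 ∷ b ∷ []) (sym σ0))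

  -- Decoding images under φ*.

  φ*-++ : ∀ x y → φ* m (x ++ y) ≡ φ* m x ++ φ* m y
  φ*-++ = concatMap-++ (φ m)

  -- A following 𝟎 hides the difference between long and short blocks: after the short block of m -
  -- 1 it stands for σ(m - 1) = 0.
  φ-𝟎 : ∀ a w → ∃[ t ] φ m a ++ 𝟎 ∷ w ≡ 𝟎 ∷ σ a ∷ t
  φ-𝟎 a w with φ-view a
  ... | inner _ eq   = 𝟎 ∷ w , cong (_++ 𝟎 ∷ w) eq
  ... | last _ eq σ0 = w , trans (cong (_++ 𝟎 ∷ w) eq) (cong (λ b → 𝟎 ∷ b ∷ w) (sym σ0))

  φ*-𝟎 : ∀ x w → ∃[ t ] φ* m x ++ 𝟎 ∷ w ≡ 𝟎 ∷ t
  φ*-𝟎 []      w = w , refl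
  φ*-𝟎 (a ∷ x) w = _ , refl

  -- Two letters suffice to decode one: the second letter either ends the block of b, or b = m - 1
  -- and it is the 𝟎 of the next block, which again equals σ(b).
  φ*-head : ∀ b v c w → φ* m (b ∷ v) ≡ 𝟎 ∷ σ c ∷ w → b ≡ c
  φ*-head b v c w eq with φ-view b
  ... | inner _ eb = σ-injective b c
    (∷-injectiveˡ (∷-injectiveʳ (trans (cong (_++ φ* m v) (sym eb)) eq)))
  ... | last _ eb σ0 = σ-injective b c (trans σ0 (first v (∷-injectiveʳ (trans (cong (_++ φ* m v) (sym eb)) eq))))
    where
    first : ∀ v → φ* m v ≡ σ c ∷ w → 𝟎 ≡ σ c
    first (_ ∷ _) e = ∷-injectiveˡ e

  -- Decoding proceeds letter by letter, since each block of x is followed by 𝟎; the final 0 σ(a)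
  -- determines a.
  φ*-decode : ∀ v x a w → φ* m v ≡ φ* m x ++ 𝟎 ∷ σ a ∷ w → ∃[ v′ ] v ≡ x ++ a ∷ v′
  φ*-decode (b ∷ v) [] a w eq with refl ← φ*-head b v a w eq = v , refl
  φ*-decode (b ∷ v) (c ∷ x) a w eq
    with t , eqt ← φ*-𝟎 x (σ a ∷ w)
    with s , eqs ← φ-𝟎 c t
    with refl ← φ*-head b v c s (trans eq (trans (++-assoc (φ m c) _ _) (trans (cong (φ m c ++_) eqt) eqs)))
    with v′ , refl ← φ*-decode v x a w (++-cancelˡ (φ m b) _ _ (trans eq (++-assoc (φ m b) _ _)))
    = v′ , refl
  φ*-decode [] [] a w ()
  φ*-decode [] (c ∷ x) a w ()

  -- The second letter of a block, if there is one, is nonzero, so every 𝟎 begins a block.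
  φ*-cut : ∀ v u w → φ* m v ≡ u ++ 𝟎 ∷ w → ∃[ v₁ ] ∃[ v₂ ] v ≡ v₁ ++ v₂ × φ* m v₁ ≡ u × φ* m v₂ ≡ 𝟎 ∷ w
  φ*-cut []      []      w ()
  φ*-cut []      (_ ∷ _) w ()
  φ*-cut (b ∷ v) []      w eq = [] , b ∷ v , refl , refl , eq
  φ*-cut (b ∷ v) (c ∷ u) w eq with φ-view b
  ... | last _ eb _
    with refl ← ∷-injectiveˡ eq
    with v₁ , v₂ , refl , refl , e₂ ← φ*-cut v u w (∷-injectiveʳ (trans (cong (_++ φ* m v) (sym eb)) eq))
    = b ∷ v₁ , v₂ , refl , cong (_++ φ* m v₁) eb , e₂
  ... | inner lt eb with u | trans (cong (_++ φ* m v) (sym eb)) eq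
  ...   | []     | e = contradiction (∷-injectiveˡ (∷-injectiveʳ e)) (σ≢𝟎 b lt)
  ...   | d ∷ u′ | e
    with refl ← ∷-injectiveˡ e | refl ← ∷-injectiveˡ (∷-injectiveʳ e)
    with v₁ , v₂ , refl , refl , e₂ ← φ*-cut v u′ w (∷-injectiveʳ (∷-injectiveʳ e))
    = b ∷ v₁ , v₂ , refl , cong (_++ φ* m v₁) eb , e₂

  -- A nonzero letter can only be the second letter of a block.
  before-nonzero : ∀ v u d w → d ≢ 𝟎 → φ* m v ≡ u ++ d ∷ w → ∃[ u₁ ] u ≡ u₁ ++ [ 𝟎 ]
  before-nonzero []      []      d w d≢ ()
  before-nonzero []      (_ ∷ _) d w d≢ ()
  before-nonzero (b ∷ v) []      d w d≢ eq = contradiction (sym (∷-injectiveˡ eq)) d≢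
  before-nonzero (b ∷ v) (c ∷ u) d w d≢ eq with φ-view b
  ... | last _ eb _
    with u₁ , refl ← before-nonzero v u d w d≢ (∷-injectiveʳ (trans (cong (_++ φ* m v) (sym eb)) eq))
    = c ∷ u₁ , refl
  ... | inner lt eb with u | trans (cong (_++ φ* m v) (sym eb)) eq
  ...   | []     | e = [] , cong [_] (sym (∷-injectiveˡ e))
  ...   | c′ ∷ u′ | e
    with u₁ , refl ← before-nonzero v u′ d w d≢ (∷-injectiveʳ (∷-injectiveʳ e))
    = c ∷ c′ ∷ u₁ , refl

  -- Prefixes of hω and their images.

  infix 4 _⊑hω

  -- A record, and some lemmas below are opaque, because with-abstraction would
  -- otherwise normalise large proof terms.
  record _⊑hω (x : Word m) : Set where
    constructor prefixᵒ
    field prefixᵒ⁻¹ : x ⊑ hω m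
  open _⊑hω public

  h⊑ : ∀ n → h m n ⊑hω
  h⊑ n = prefixᵒ (h⊑hω m n)

  opaque
    ⊑-prefix : ∀ u {v} → u ++ v ⊑hω → u ⊑hω
    ⊑-prefix u (prefixᵒ q) = prefixᵒ (⊑-++⁻ m (hω m) u _ q)

  opaque
    ⊑-compare : ∀ u x → u ⊑hω → x ⊑hω → length u ≤ length x → ∃[ v ] x ≡ u ++ v
    ⊑-compare u x (prefixᵒ q) (prefixᵒ r) = ⊑-≤ m (hω m) u x q r

  opaque
    φ*-cover : ∀ x → x ⊑hω → ∃[ v ] ∃[ t ] v ⊑hω × φ* m v ≡ x ++ t
    φ*-cover x x⊑ =
      let n = length x
          t , eq = ⊑-compare x (h m (suc n)) x⊑ (h⊑ (suc n)) (<⇒≤ (<-trans (n<1+n n) (n<length-h m (suc n))))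
      in h m n , t , h⊑ n , eq

  -- Some letter continues x in hω, and its block starts with 𝟎.
  ⊑-φ*-𝟎 : ∀ x → x ⊑hω → φ* m x ++ [ 𝟎 ] ⊑hω
  ⊑-φ*-𝟎 x x⊑ with ⊑-compare x (h m (length x)) x⊑ (h⊑ (length x)) (<⇒≤ (n<length-h m (length x)))
  ... | [] , eq = contradiction
          (subst (length x <_) (cong length (trans eq (++-identityʳ x))) (n<length-h m (length x))) (n≮n _)
  ... | a ∷ v , eq = ⊑-prefix (φ* m x ++ [ 𝟎 ]) (subst _⊑hω
          (trans (cong (φ* m) eq) (trans (φ*-++ x (a ∷ v)) (sym (++-assoc (φ* m x) [ 𝟎 ] _))))
          (h⊑ (suc (length x))))

  -- The map T and desubstitution.

  -- φ*(y), continued up to the letter that determines the last letter of y.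
  T : Word m → Word m
  T []          = []
  T (a ∷ [])    = 𝟎 ∷ σ a ∷ []
  T (a ∷ b ∷ x) = φ m a ++ T (b ∷ x)

  T-∷ʳ : ∀ x a → T (x ∷ʳ a) ≡ φ* m x ++ 𝟎 ∷ σ a ∷ []
  T-∷ʳ []          a = refl
  T-∷ʳ (b ∷ [])    a = cong (_++ 𝟎 ∷ σ a ∷ []) (sym (++-identityʳ (φ m b)))
  T-∷ʳ (b ∷ c ∷ x) a = trans (cong (φ m b ++_) (T-∷ʳ (c ∷ x) a)) (sym (++-assoc (φ m b) _ _))

  T-carry : ∀ x a → T (x ∷ʳ a) ≡ φ* m (x ∷ʳ a) ++ carry a
  T-carry x a = begin
    T (x ∷ʳ a)                        ≡⟨ T-∷ʳ x a ⟩
    φ* m x ++ 𝟎 ∷ σ a ∷ []            ≡⟨ cong (φ* m x ++_) (φ-carry a) ⟨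
    φ* m x ++ φ m a ++ carry a        ≡⟨ ++-assoc (φ* m x) _ _ ⟨
    (φ* m x ++ φ m a) ++ carry a      ≡⟨ cong (λ y → (φ* m x ++ y) ++ carry a) (++-identityʳ (φ m a)) ⟨
    (φ* m x ++ φ m a ++ []) ++ carry a ≡⟨ cong (_++ carry a) (φ*-++ x [ a ]) ⟨
    φ* m (x ∷ʳ a) ++ carry a          ∎
    where open ≡-Reasoning

  -- The right factor is kept non-empty by `∷ʳ`, since T treats the last letter differently from the
  -- others.
  T-++-∷ʳ : ∀ u x a → T (u ++ x ∷ʳ a) ≡ φ* m u ++ T (x ∷ʳ a)
  T-++-∷ʳ u x a = begin
    T (u ++ x ∷ʳ a)                          ≡⟨ cong T (++-assoc u x [ a ]) ⟨
    T ((u ++ x) ∷ʳ a)                        ≡⟨ T-∷ʳ (u ++ x) a ⟩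
    φ* m (u ++ x) ++ 𝟎 ∷ σ a ∷ []            ≡⟨ cong (_++ _) (φ*-++ u x) ⟩
    (φ* m u ++ φ* m x) ++ 𝟎 ∷ σ a ∷ []       ≡⟨ ++-assoc (φ* m u) _ _ ⟩
    φ* m u ++ φ* m x ++ 𝟎 ∷ σ a ∷ []         ≡⟨ cong (φ* m u ++_) (T-∷ʳ x a) ⟨
    φ* m u ++ T (x ∷ʳ a)                     ∎
    where open ≡-Reasoning

  ⊑-T : ∀ x a → x ∷ʳ a ⊑hω → T (x ∷ʳ a) ⊑hω
  ⊑-T x a x⊑ with φ-view a | T-carry x a | ⊑-φ*-𝟎 (x ∷ʳ a) x⊑
  ... | inner _ _  | eq | q = subst _⊑hω (sym (trans eq (++-identityʳ _))) (⊑-prefix (φ* m (x ∷ʳ a)) q)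
  ... | last _ _ _ | eq | q = subst _⊑hω (sym eq) q

  ⊑-φ*-T : ∀ p x a → p ++ x ∷ʳ a ⊑hω → φ* m p ++ T (x ∷ʳ a) ⊑hω
  ⊑-φ*-T p x a q = subst _⊑hω (trans (cong T (++-assoc p x [ a ])) (T-++-∷ʳ p x a))
    (⊑-T (p ++ x) a (subst _⊑hω (sym (++-assoc p x [ a ])) q))

  T-σ : ∀ a x → ∃[ t ] T (a ∷ x) ≡ 𝟎 ∷ σ a ∷ t
  T-σ a []      = [] , refl
  T-σ a (b ∷ x)
    with t , eq ← T-σ b x
    with s , eq′ ← φ-𝟎 a (σ b ∷ t) = s , trans (cong (φ m a ++_) eq) eq′

  -- T(xa) starts with 𝟎, so u′ ends at a block boundary, and the blocks after it decode to xa.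
  desubstitute : ∀ u′ x a → u′ ++ T (x ∷ʳ a) ⊑hω → ∃[ u ] u′ ≡ φ* m u × u ++ x ∷ʳ a ⊑hω
  desubstitute u′ x a q
    with v , t , v⊑ , eq ← φ*-cover (u′ ++ T (x ∷ʳ a)) q
    with s , eqs ← φ*-𝟎 x (σ a ∷ t)
    with eq′ ← trans eq (trans (++-assoc u′ _ t) (cong (u′ ++_)
           (trans (cong (_++ t) (T-∷ʳ x a)) (++-assoc (φ* m x) _ t))))
    with v₁ , v₂ , refl , refl , e₂ ← φ*-cut v u′ s (trans eq′ (cong (u′ ++_) eqs))
    with v₃ , refl ← φ*-decode v₂ x a t (trans e₂ (sym eqs))
    = v₁ , refl , ⊑-prefix (v₁ ++ x ∷ʳ a) (subst _⊑hω
        (trans (cong (v₁ ++_) (sym (++-assoc x [ a ] v₃))) (sym (++-assoc v₁ _ v₃))) v⊑)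

  -- Images with a leading 𝟎 removed.

  -- The two ways in which e ++ y ≡ T z can define the successor y of z.
  Shift : Word m → Word m → Set
  Shift e z = e ≡ [] ⊎ (e ≡ [ 𝟎 ] × ∃[ t ] z ≡ 𝟎 ∷ t)

  -- A non-empty image starts with 𝟎, so φ*(x) e starts with e. The length bound keeps non-empty
  -- words non-empty.
  conjugate : ∀ {e z} → Shift e z → ∀ x → ∃[ x′ ] e ++ x′ ≡ φ* m x ++ e × length x ≤ length x′
  conjugate (inj₁ refl)       x       = φ* m x , sym (++-identityʳ _) , length-φ* m x
  conjugate (inj₂ (refl , _)) []      = [] , refl , z≤n
  conjugate (inj₂ (refl , _)) (b ∷ x) = _ , refl , ≤-trans (length-φ* m (b ∷ x))
    (≤-reflexive (trans (+-comm 1 _) (sym (length-++ (drop 1 (φ* m (b ∷ x)))))))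

  -- For x = B, the word φ*(B) 0 is T(Ba) without its last letter; removing e from its front gives
  -- the next B.
  conjugate-𝟎 : ∀ {e z} → Shift e z → ∀ x → ∃[ x′ ] e ++ x′ ≡ φ* m x ++ [ 𝟎 ]
  conjugate-𝟎 (inj₁ refl)         x = _ , refl
  conjugate-𝟎 s@(inj₂ (refl , _)) x = let x′ , eq , _ = conjugate s x in x′ , eq

  σ𝟎≢𝟎 : σ 𝟎 ≢ 𝟎
  σ𝟎≢𝟎 = σ≢𝟎 𝟎 (subst (λ k → suc k < m) (sym (toℕ-letter-0 m)) (1<m m))

  -- If e = 0, then xa starts with 𝟎, so y starts with σ(0), which is nonzero. The letter before y
  -- is therefore 𝟎; giving it back to y restores T(xa), and `desubstitute` applies.
  pull-back : ∀ {e} x a {y} u′ → Shift e (x ∷ʳ a) → e ++ y ≡ T (x ∷ʳ a) → u′ ++ y ⊑hω →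
              ∃[ u ] u′ ≡ φ* m u ++ e × u ++ x ∷ʳ a ⊑hω
  pull-back x a u′ (inj₁ refl) eq q
    with u , refl , r ← desubstitute u′ x a (subst (λ y → u′ ++ y ⊑hω) eq q)
    = u , sym (++-identityʳ _) , r
  pull-back x a {y} u′ (inj₂ (refl , t , x≡)) eq q
    with s , eqs ← T-σ 𝟎 t
    with y≡ ← ∷-injectiveʳ (trans eq (trans (cong T x≡) eqs))
    with v , r , _ , eqv ← φ*-cover (u′ ++ y) q
    with u₁ , refl ← before-nonzero v u′ (σ 𝟎) (s ++ r) σ𝟎≢𝟎
           (trans eqv (trans (++-assoc u′ y r) (cong (λ y → u′ ++ y ++ r) y≡)))
    with u , refl , q′ ← desubstitute u₁ x a
           (subst _⊑hω (trans (++-assoc u₁ [ 𝟎 ] y) (cong (u₁ ++_) eq)) q)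
    = u , refl , q′

  -- Blocks differ in length, so this rests on u being a prefix of p.
  φ*-mono : ∀ u p → u ⊑hω → p ⊑hω → length u ≤ length p → length (φ* m u) ≤ length (φ* m p)
  φ*-mono u p u⊑ p⊑ le with v , refl ← ⊑-compare u p u⊑ p⊑ le =
    subst (λ x → length (φ* m u) ≤ length x) (sym (φ*-++ u v)) (length-++-≤ˡ (φ* m u))

  φ*-mono-< : ∀ u p → u ⊑hω → p ⊑hω → length u < length p → length (φ* m u) < length (φ* m p)
  φ*-mono-< u p u⊑ p⊑ lt with ⊑-compare u p u⊑ p⊑ (<⇒≤ lt)
  ... | [] , refl    = contradiction (≤-reflexive (cong length (++-identityʳ u))) (<⇒≱ lt)
  ... | a ∷ v , refl = subst (length (φ* m u) <_)
          (sym (trans (cong length (φ*-++ u (a ∷ v))) (length-++ (φ* m u))))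
          (m<m+n _ z<s)

  length-T : ∀ x a → length (T (x ∷ʳ a)) ≡ length (φ* m x) + 2
  length-T x a = trans (cong length (T-∷ʳ x a)) (length-++ (φ* m x))

  T-mono : ∀ x a y b → x ∷ʳ a ⊑hω → y ∷ʳ b ⊑hω → length (x ∷ʳ a) ≤ length (y ∷ʳ b) →
           length (T (x ∷ʳ a)) ≤ length (T (y ∷ʳ b))
  T-mono x a y b x⊑ y⊑ le = subst₂ _≤_ (sym (length-T x a)) (sym (length-T y b)) (+-monoˡ-≤ 2
    (φ*-mono x y (⊑-prefix x x⊑) (⊑-prefix y y⊑)
      (+-cancelʳ-≤ 1 _ _ (subst₂ _≤_ (length-++ x) (length-++ y) le))))

  -- Good pairs and their transport under φ.

  -- z is the factor after the prefix p: its border witnessing closedness is B a,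
  -- and g B, which also follows p, occurs earlier and contains B twice.
  record Good (p z : Word m) : Set where
    field
      B v g w   : Word m
      a         : Fin m
      z-end     : z ≡ v ++ B ∷ʳ a
      v-nonempty : 0 < length v
      g-nonempty : 0 < length g
      z-here    : p ++ z ⊑hω
      b-here    : p ++ B ∷ʳ a ⊑hω
      r-here    : p ++ g ++ B ⊑hω
      r-earlier : w ++ g ++ B ⊑hω
      w<p       : length w < length p
      first     : ∀ u → u ++ z ⊑hω → length p ≤ length u
      returns   : ∀ u → u ++ B ∷ʳ a ⊑hω →
                  length u ≤ length p ⊎ length (p ++ z) ≤ length (u ++ B ∷ʳ a)

  ∷ʳ-∷ : ∀ (x : Word m) a → ∃[ c ] ∃[ t ] x ∷ʳ a ≡ c ∷ t
  ∷ʳ-∷ []      a = a , [] , refl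
  ∷ʳ-∷ (c ∷ x) a = c , x ∷ʳ a , refl

  opaque
    prefix-here : ∀ p x y → p ++ x ⊑hω → p ++ y ⊑hω → length x ≤ length y → ∃[ s ] y ≡ x ++ s
    prefix-here p x y q r le
      with s , eq ← ⊑-compare (p ++ x) (p ++ y) q r (subst₂ _≤_ (sym (length-++ p)) (sym (length-++ p)) (+-monoʳ-≤ (length p) le))
      = s , ++-cancelˡ p _ _ (trans eq (++-assoc p x s))

  -- The words v and g are replaced by their images conjugated by e, and Ba by T(Ba) with e removed.
  -- Occurrences of the new words pull back to occurrences of the old ones, and monotonicity of φ*
  -- and T on prefixes of hω carries the inequalities over.
  Good-step : ∀ {p z e z′} → Shift e z → e ++ z′ ≡ T z → Good p z → Good (φ* m p ++ e) z′
  Good-step {p} {z} {e} {z′} shift ez′≡ G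
    with v′ , v≡ , |v′| ← conjugate shift (Good.v G)
    with g′ , g≡ , |g′| ← conjugate shift (Good.g G)
    with B′ , B≡ ← conjugate-𝟎 shift (Good.B G)
    = record
      { B = B′ ; v = v′ ; g = g′ ; w = φ* m w ++ e ; a = σ a
      ; z-end = ++-cancelˡ e _ _ (begin
          e ++ z′                      ≡⟨ ez′≡ ⟩
          T z                          ≡⟨ cong T z-end ⟩
          T (v ++ B ∷ʳ a)              ≡⟨ T-++-∷ʳ v B a ⟩
          φ* m v ++ T (B ∷ʳ a)         ≡⟨ cong (φ* m v ++_) eb′≡ ⟨
          φ* m v ++ e ++ B′ ∷ʳ σ a     ≡⟨ ++-assoc (φ* m v) e _ ⟨
          (φ* m v ++ e) ++ B′ ∷ʳ σ a   ≡⟨ cong (_++ B′ ∷ʳ σ a) v≡ ⟨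
          (e ++ v′) ++ B′ ∷ʳ σ a       ≡⟨ ++-assoc e v′ _ ⟩
          e ++ v′ ++ B′ ∷ʳ σ a         ∎)
      ; v-nonempty = ≤-trans v-nonempty |v′|
      ; g-nonempty = ≤-trans g-nonempty |g′|
      ; z-here = subst _⊑hω (sym pz′≡)
          (⊑-φ*-T p (v ++ B) a (subst (λ y → p ++ y ⊑hω) z-end′ z-here))
      ; b-here = subst _⊑hω (sym (∷-eb′ p)) (⊑-φ*-T p B a b-here)
      ; r-here = r′ p r-here
      ; r-earlier = r′ w r-earlier
      ; w<p = subst₂ _<_ (sym (length-++ (φ* m w))) (sym (length-++ (φ* m p)))
          (+-monoˡ-< (length e) (φ*-mono-< w p (⊑-prefix w r-earlier) p⊑ w<p))
      ; first = first′
      ; returns = returns′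
      }
    where
    open Good G
    open ≡-Reasoning

    p⊑ : p ⊑hω
    p⊑ = ⊑-prefix p z-here

    z-end′ : z ≡ (v ++ B) ∷ʳ a
    z-end′ = trans z-end (sym (++-assoc v B [ a ]))

    eb′≡ : e ++ B′ ∷ʳ σ a ≡ T (B ∷ʳ a)
    eb′≡ = begin
      e ++ B′ ∷ʳ σ a                 ≡⟨ ++-assoc e B′ _ ⟨
      (e ++ B′) ∷ʳ σ a               ≡⟨ cong (_∷ʳ σ a) B≡ ⟩
      (φ* m B ++ [ 𝟎 ]) ∷ʳ σ a       ≡⟨ ++-assoc (φ* m B) _ _ ⟩
      φ* m B ++ 𝟎 ∷ σ a ∷ []         ≡⟨ T-∷ʳ B a ⟨
      T (B ∷ʳ a)                     ∎

    pz′≡ : (φ* m p ++ e) ++ z′ ≡ φ* m p ++ T ((v ++ B) ∷ʳ a)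
    pz′≡ = trans (++-assoc (φ* m p) e z′) (cong (φ* m p ++_) (trans ez′≡ (cong T z-end′)))

    ∷-eb′ : ∀ u → (φ* m u ++ e) ++ B′ ∷ʳ σ a ≡ φ* m u ++ T (B ∷ʳ a)
    ∷-eb′ u = trans (++-assoc (φ* m u) e _) (cong (φ* m u ++_) eb′≡)

    -- The letter after gB may differ between its two occurrences, but its block starts with 𝟎 in
    -- any case, so φ*(gB) 0 occurs at both places.
    r′ : ∀ u → u ++ g ++ B ⊑hω → (φ* m u ++ e) ++ g′ ++ B′ ⊑hω
    r′ u q = subst _⊑hω eq (⊑-φ*-𝟎 (u ++ g ++ B) q)
      where
      eq : φ* m (u ++ g ++ B) ++ [ 𝟎 ] ≡ (φ* m u ++ e) ++ g′ ++ B′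
      eq = begin
        φ* m (u ++ g ++ B) ++ [ 𝟎 ]               ≡⟨ cong (_++ [ 𝟎 ]) (trans (φ*-++ u _) (cong (φ* m u ++_) (φ*-++ g B))) ⟩
        (φ* m u ++ φ* m g ++ φ* m B) ++ [ 𝟎 ]     ≡⟨ ++-assoc (φ* m u) _ _ ⟩
        φ* m u ++ (φ* m g ++ φ* m B) ++ [ 𝟎 ]     ≡⟨ cong (φ* m u ++_) (++-assoc (φ* m g) _ _) ⟩
        φ* m u ++ φ* m g ++ φ* m B ++ [ 𝟎 ]       ≡⟨ cong (λ y → φ* m u ++ φ* m g ++ y) B≡ ⟨
        φ* m u ++ φ* m g ++ e ++ B′               ≡⟨ cong (φ* m u ++_) (++-assoc (φ* m g) e B′) ⟨
        φ* m u ++ (φ* m g ++ e) ++ B′             ≡⟨ cong (λ y → φ* m u ++ y ++ B′) g≡ ⟨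
        φ* m u ++ (e ++ g′) ++ B′                 ≡⟨ cong (φ* m u ++_) (++-assoc e g′ B′) ⟩
        φ* m u ++ e ++ g′ ++ B′                   ≡⟨ ++-assoc (φ* m u) e _ ⟨
        (φ* m u ++ e) ++ g′ ++ B′                 ∎

    φe-mono : ∀ u q → u ⊑hω → q ⊑hω → length u ≤ length q → length (φ* m u ++ e) ≤ length (φ* m q ++ e)
    φe-mono u q u⊑ q⊑ le = subst₂ _≤_ (sym (length-++ (φ* m u))) (sym (length-++ (φ* m q)))
      (+-monoˡ-≤ (length e) (φ*-mono u q u⊑ q⊑ le))

    -- Both Ba and z follow p, so Ba is a prefix of z and shares its first letter.
    shift-b : Shift e z → Shift e (B ∷ʳ a)
    shift-b (inj₁ e≡) = inj₁ e≡
    shift-b (inj₂ (e≡ , t , z≡))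
      with s , eq ← prefix-here p (B ∷ʳ a) z b-here z-here
             (subst (λ y → length (B ∷ʳ a) ≤ length y) (sym z-end) (length-++-≤ʳ (B ∷ʳ a) {v}))
      with c , t′ , b≡ ← ∷ʳ-∷ B a
      = inj₂ (e≡ , t′ , trans b≡ (cong (_∷ t′)
          (∷-injectiveˡ (trans (sym (trans eq (cong (_++ s) b≡))) z≡))))

    first′ : ∀ u → u ++ z′ ⊑hω → length (φ* m p ++ e) ≤ length u
    first′ u′ q
      with u , refl , r ← pull-back (v ++ B) a u′ (subst (Shift e) z-end′ shift) (trans ez′≡ (cong T z-end′)) q
      = φe-mono p u p⊑ (⊑-prefix u r) (first u (subst (λ y → u ++ y ⊑hω) (sym z-end′) r))

    returns′ : ∀ u → u ++ B′ ∷ʳ σ a ⊑hω →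
      length u ≤ length (φ* m p ++ e) ⊎ length ((φ* m p ++ e) ++ z′) ≤ length (u ++ B′ ∷ʳ σ a)
    returns′ u′ q with u , refl , r ← pull-back B a u′ (shift-b shift) eb′≡ q with returns u r
    ... | inj₁ le = inj₁ (φe-mono u p (⊑-prefix u r) p⊑ le)
    -- The prefixes of hω ending in z′ and in the new border are T(pz) and T(uBa).
    ... | inj₂ le = inj₂ (subst₂ _≤_
        (cong length (trans (cong T (++-assoc p (v ++ B) [ a ])) (trans (T-++-∷ʳ p (v ++ B) a) (sym pz′≡))))
        (cong length (trans (cong T (++-assoc u B [ a ])) (trans (T-++-∷ʳ u B a) (sym (∷-eb′ u)))))
        (T-mono (p ++ v ++ B) a (u ++ B) a (subst _⊑hω pz≡ z-here) (subst _⊑hω ub≡ r)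
          (subst₂ _≤_ (cong length pz≡) (cong length ub≡) le)))
      where
      pz≡ : p ++ z ≡ (p ++ v ++ B) ∷ʳ a
      pz≡ = trans (cong (p ++_) z-end′) (sym (++-assoc p (v ++ B) [ a ]))
      ub≡ : u ++ B ∷ʳ a ≡ (u ++ B) ∷ʳ a
      ub≡ = sym (++-assoc u B [ a ])

  -- Occurrences, closedness and minimality.

  ⊑-OccursAt : ∀ y → y ⊑hω → ∀ {x i} → OccursAt x y i →
               ∃[ u ] length u ≡ i × u ++ x ⊑hω × length (u ++ x) ≤ length y
  ⊑-OccursAt _ y⊑ {x} (u , v , refl , |u|≡i) =
    u , |u|≡i , ⊑-prefix (u ++ x) ux⊑ , subst (λ y → length (u ++ x) ≤ length y) (++-assoc u x v) (length-++-≤ˡ (u ++ x))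
    where
    ux⊑ : (u ++ x) ++ v ⊑hω
    ux⊑ = subst _⊑hω (sym (++-assoc u x v)) y⊑

  -- Together with `⊑-OccursAt`, this turns counting occurrences in a prefix y of hω into comparing
  -- lengths of prefixes of hω that end in x.
  OccursAt-⊑ : ∀ y → y ⊑hω → ∀ u x → u ++ x ⊑hω → length (u ++ x) ≤ length y → OccursAt x y (length u)
  OccursAt-⊑ y y⊑ u x ux⊑ le with v , eq ← ⊑-compare (u ++ x) y ux⊑ y⊑ le =
    u , v , trans eq (++-assoc u x v) , refl

  -- An occurrence has to fit into px, so it cannot start after p; by hypothesis it cannot start
  -- earlier.
  first⇒once : ∀ p x → p ++ x ⊑hω → (∀ u → u ++ x ⊑hω → length p ≤ length u) → OccursOnce x (p ++ x)
  first⇒once p x px⊑ first =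
    length p , OccursAt-⊑ (p ++ x) px⊑ p x px⊑ ≤-refl , unique
    where
    unique : ∀ k → OccursAt x (p ++ x) k → k ≡ length p
    unique k o with u , refl , ux⊑ , le ← ⊑-OccursAt (p ++ x) px⊑ o =
      ≤-antisym (+-length-≤ u p x le) (first u ux⊑)

  earlier⇒¬once : ∀ p w x → p ++ x ⊑hω → w ++ x ⊑hω → length w < length p → OccursOnce x (p ++ x) → ⊥
  earlier⇒¬once p w x px⊑ wx⊑ lt (i , _ , unique) = <⇒≢ lt (trans
    (unique _ (OccursAt-⊑ (p ++ x) px⊑ w x wx⊑ (subst₂ _≤_ (sym (length-++ w)) (sym (length-++ p))
      (+-monoˡ-≤ (length x) (<⇒≤ lt)))))
    (sym (unique _ (OccursAt-⊑ (p ++ x) px⊑ p x px⊑ ≤-refl))))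

  ¬three-occurrences : ∀ {x y : Word m} {k l n} → k < l → l < n →
    OccursAt x y k → OccursAt x y l → OccursAt x y n → OccursTwice x y → ⊥
  ¬three-occurrences k<l l<n ok ol on (_ , _ , _ , _ , _ , only) with only _ ok | only _ ol | only _ on
  ... | inj₁ refl | inj₁ refl | _         = n≮n _ k<l
  ... | inj₂ refl | inj₂ refl | _         = n≮n _ k<l
  ... | _         | inj₁ refl | inj₁ refl = n≮n _ l<n
  ... | _         | inj₂ refl | inj₂ refl = n≮n _ l<n
  ... | inj₁ refl | inj₂ refl | inj₁ refl = n≮n _ (<-trans k<l l<n)
  ... | inj₂ refl | inj₁ refl | inj₂ refl = n≮n _ (<-trans k<l l<n)

  module _ {p z : Word m} (G : Good p z) where
    open Good G

    private
      b = B ∷ʳ a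

      |z| : length z ≡ length v + length b
      |z| = trans (cong length z-end) (length-++ v)

      z-starts : ∃[ s ] z ≡ b ++ s
      z-starts = prefix-here p b z b-here z-here (subst (length b ≤_) (sym |z|) (m≤n+m _ (length v)))

    Good-closed : Closed z
    Good-closed = z≢[] , inj₂ (b , (b≢[] , ∣ˡ-as-Prefix (quotient _ (sym (proj₂ z-starts))) , ∣ʳ-as-Suffix (quotient v (sym z-end))) ,
      0 , length v , v-nonempty , ([] , _ , proj₂ z-starts , refl) ,
      (v , [] , trans z-end (cong (v ++_) (sym (++-identityʳ b))) , refl) , only)
      where
      b≢[] : b ≢ []
      b≢[] eq with () ← trans (sym eq) (proj₂ (proj₂ (∷ʳ-∷ B a)))
      z≢[] : z ≢ []
      z≢[] eq = contradiction (trans (sym |z|) (cong length eq)) (>⇒≢ (<-≤-trans v-nonempty (m≤m+n _ _)))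

      -- Seen in hω, the occurrence starts at |p| + k; by `returns` it starts where z starts or ends
      -- where z ends.
      only : ∀ k → OccursAt b z k → k ≡ 0 ⊎ k ≡ length v
      only k (u , s , eq , refl) with returns (p ++ u) (⊑-prefix ((p ++ u) ++ b) (subst _⊑hω
          (trans (cong (p ++_) eq) (trans (sym (++-assoc p u (b ++ s))) (sym (++-assoc (p ++ u) b s)))) z-here))
      ... | inj₁ le = inj₁ (n≤0⇒n≡0 (+-cancelˡ-≤ (length p) _ _
              (subst₂ _≤_ (length-++ p) (sym (+-identityʳ (length p))) le)))
      ... | inj₂ le = inj₂ (≤-antisym
              (+-cancelʳ-≤ (length b) _ _ (begin
                length u + length b          ≡⟨ length-++ u ⟨
                length (u ++ b)              ≤⟨ length-++-≤ˡ (u ++ b) ⟩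
                length ((u ++ b) ++ s)       ≡⟨ cong length (trans (++-assoc u b s) (sym eq)) ⟩
                length z                     ≡⟨ |z| ⟩
                length v + length b          ∎))
              (+-cancelʳ-≤ (length b) _ _ (+-cancelˡ-≤ (length p) _ _ (begin
                length p + (length v + length b) ≡⟨ cong (length p +_) |z| ⟨
                length p + length z              ≡⟨ length-++ p ⟨
                length (p ++ z)                  ≤⟨ le ⟩
                length ((p ++ u) ++ b)           ≡⟨ cong length (++-assoc p u b) ⟩
                length (p ++ u ++ b)             ≡⟨ length-++ p ⟩
                length p + length (u ++ b)       ≡⟨ cong (length p +_) (length-++ u) ⟩
                length p + (length u + length b) ∎))))
        where open ≤-Reasoning

    Good-candidate : Candidate (hω m) p z
    Good-candidate = ⊑-drop (hω m) p (prefixᵒ⁻¹ z-here) , Good-closed , first⇒once p z z-here first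

    Good-shortest : ∀ x → Candidate (hω m) p x → length z ≤ length x
    Good-shortest x (x⊑ , (x≢[] , closed) , once) = ≮⇒≥ (λ |x|<|z| → refute |x|<|z| closed)
      where
      r = g ++ B

      px⊑ : p ++ x ⊑hω
      px⊑ = prefixᵒ (⊑-glue (hω m) p (prefixᵒ⁻¹ (⊑-prefix p z-here)) x⊑)

      -- Otherwise x is a prefix of gB and so already occurs after w.
      long : length r < length x
      long = ≰⇒> λ le → let s , r≡ = prefix-here p x r px⊑ r-here le in
        earlier⇒¬once p w x px⊑
          (⊑-prefix (w ++ x) (subst _⊑hω (trans (cong (w ++_) r≡) (sym (++-assoc w x s))) r-earlier))
          w<p once

      |r| : length r ≡ length g + length B
      |r| = length-++ g

      refute : length x < length z → length x ≡ 1 ⊎ (∃[ y ] Border y x × OccursTwice y x) → ⊥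
      refute _ (inj₁ |x|≡1) = <⇒≱ long (subst (_≤ length r) (sym |x|≡1)
        (≤-trans g-nonempty (length-++-≤ˡ g)))
      refute |x|<|z| (inj₂ (y , (_ , prefix , suffix) , twice@(i , j , i<j , _ , (u , t , x≡ , |u|≡j) , _)))
        with quotient s ys≡x ← Prefix-as-∣ˡ prefix | quotient s′ s′y≡x ← Suffix-as-∣ʳ suffix
        = by-length (≤-<-connex (length y) (length B))
        where
        py⊑ : p ++ y ⊑hω
        py⊑ = ⊑-prefix (p ++ y) (subst _⊑hω (trans (cong (p ++_) (sym ys≡x)) (sym (++-assoc p y s))) px⊑)

        pB⊑ : p ++ B ⊑hω
        pB⊑ = ⊑-prefix (p ++ B) (subst _⊑hω (sym (++-assoc p B [ a ])) b-here)

        by-length : length y ≤ length B ⊎ length B < length y → ⊥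
        -- Here y is a prefix of B, so it occurs in x at 0, at |g|, and as a suffix. The suffix
        -- starts after |g| because x is longer than gB.
        by-length (inj₁ le)
          with o , B≡ ← prefix-here p y B py⊑ pB⊑ le
          with q , x≡rq ← prefix-here p r x r-here px⊑ (<⇒≤ long)
          = ¬three-occurrences g-nonempty g<s′
              ([] , s , sym ys≡x , refl)
              (g , o ++ q , trans x≡rq (trans (++-assoc g B q) (cong (g ++_) (trans (cong (_++ q) B≡) (++-assoc y o q)))) , refl)
              (s′ , [] , trans (sym s′y≡x) (cong (s′ ++_) (sym (++-identityʳ y))) , refl)
              twice
          where
          g<s′ : length g < length s′
          g<s′ = +-cancelʳ-< (length y) _ _ (begin-strict
            length g + length y   ≤⟨ +-monoʳ-≤ (length g) le ⟩
            length g + length B   ≡⟨ |r| ⟨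
            length r              <⟨ long ⟩
            length x              ≡⟨ cong length s′y≡x ⟨
            length (s′ ++ y)      ≡⟨ length-++ s′ ⟩
            length s′ + length y  ∎)
            where open ≤-Reasoning
        -- Here Ba is a prefix of y. The second occurrence of y in x contains an occurrence of Ba
        -- that starts after the beginning of z and ends before its end, against `returns`.
        by-length (inj₂ lt)
          with o , y≡ ← prefix-here p b y b-here py⊑ (subst (_≤ length y) (sym (trans (length-++ B) (+-comm (length B) 1))) lt)
          = case (returns (p ++ u) (⊑-prefix ((p ++ u) ++ b) (subst _⊑hω px≡ px⊑)))
          where
          x≡′ : x ≡ (u ++ b) ++ o ++ t
          x≡′ = trans x≡ (trans (cong (λ y → u ++ y ++ t) y≡)
            (trans (cong (u ++_) (++-assoc b o t)) (sym (++-assoc u b (o ++ t)))))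

          px≡ : p ++ x ≡ ((p ++ u) ++ b) ++ o ++ t
          px≡ = trans (cong (p ++_) x≡′) (trans (sym (++-assoc p (u ++ b) (o ++ t)))
            (cong (_++ o ++ t) (sym (++-assoc p u b))))

          case : length (p ++ u) ≤ length p ⊎ length (p ++ z) ≤ length ((p ++ u) ++ b) → ⊥
          case (inj₁ le) = <⇒≱ (subst (length p <_) (sym (length-++ p))
            (m<m+n (length p) (subst (0 <_) (sym |u|≡j) (≤-trans (s≤s z≤n) i<j)))) le
          case (inj₂ le) = <⇒≱ |x|<|z| (+-cancelˡ-≤ (length p) _ _ (begin
            length p + length z                  ≡⟨ length-++ p ⟨
            length (p ++ z)                      ≤⟨ le ⟩
            length ((p ++ u) ++ b)               ≤⟨ length-++-≤ˡ ((p ++ u) ++ b) ⟩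
            length (((p ++ u) ++ b) ++ o ++ t)   ≡⟨ cong length px≡ ⟨
            length (p ++ x)                      ≡⟨ length-++ p ⟩
            length p + length x                  ∎))
            where open ≤-Reasoning

  -- Reversal and the numerators of zₙ.

  φᴿ : Word m → Word m
  φᴿ = concatMap (λ a → reverse (φ m a))

  -- Each φ(a) 0 is a palindrome, 0 σ(a) 0 or 0 0, so moving the final 𝟎 to the front reverses every
  -- block it passes.
  φ*-φᴿ : ∀ x → φ* m x ++ [ 𝟎 ] ≡ 𝟎 ∷ φᴿ x
  φ*-φᴿ []      = refl
  φ*-φᴿ (a ∷ x) = begin
    (φ m a ++ φ* m x) ++ [ 𝟎 ]                ≡⟨ ++-assoc (φ m a) _ _ ⟩
    φ m a ++ φ* m x ++ [ 𝟎 ]                  ≡⟨ cong (φ m a ++_) (φ*-φᴿ x) ⟩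
    φ m a ++ [ 𝟎 ] ++ φᴿ x                     ≡⟨ ++-assoc (φ m a) _ _ ⟨
    (φ m a ++ [ 𝟎 ]) ++ φᴿ x                   ≡⟨ cong (_++ φᴿ x) (block a) ⟩
    𝟎 ∷ reverse (φ m a) ++ φᴿ x                ∎
    where
    open ≡-Reasoning
    block : ∀ a → φ m a ++ [ 𝟎 ] ≡ 𝟎 ∷ reverse (φ m a)
    block a with φ-view a
    ... | inner _ eq  = trans (cong (_++ [ 𝟎 ]) eq) (cong (λ y → 𝟎 ∷ reverse y) (sym eq))
    ... | last _ eq _ = trans (cong (_++ [ 𝟎 ]) eq) (cong (λ y → 𝟎 ∷ reverse y) (sym eq))

  φᴿ-reverse : ∀ x → φᴿ (reverse x) ≡ reverse (φ* m x)
  φᴿ-reverse []      = refl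
  φᴿ-reverse (a ∷ x) = begin
    φᴿ (reverse (a ∷ x))                    ≡⟨ cong φᴿ (unfold-reverse a x) ⟩
    φᴿ (reverse x ∷ʳ a)                     ≡⟨ concatMap-++ _ (reverse x) [ a ] ⟩
    φᴿ (reverse x) ++ reverse (φ m a) ++ [] ≡⟨ cong₂ _++_ (φᴿ-reverse x) (++-identityʳ _) ⟩
    reverse (φ* m x) ++ reverse (φ m a)     ≡⟨ reverse-++ (φ m a) (φ* m x) ⟨
    reverse (φ m a ++ φ* m x)               ∎
    where open ≡-Reasoning

  φᴿ-hᴿ : ∀ (f : ℕ → ℕ) n → φᴿ (concat (map (λ j → reverse (h m (f j))) (upTo n))) ≡
                              concat (map (λ j → reverse (h m (suc (f j)))) (upTo n))
  φᴿ-hᴿ f n = go (upTo n)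
    where
    go : ∀ js → φᴿ (concat (map (λ j → reverse (h m (f j))) js)) ≡ concat (map (λ j → reverse (h m (suc (f j)))) js)
    go []       = refl
    go (j ∷ js) = trans (concatMap-++ _ (reverse (h m (f j))) _) (cong₂ _++_ (φᴿ-reverse (h m (f j))) (go js))

  -- The word h₀ᴿ is 0, so a 𝟎 in front of a product starting at index 1 is its factor of index 0.
  hᴿ-first : ∀ n → [ 𝟎 ] ++ hᴿ⟨_⋯_⟩ m 1 (suc n) ≡ hᴿ⟨_⋯_⟩ m 0 (suc n)
  hᴿ-first n = cong (λ js → 𝟎 ∷ concat js) (trans (map-upTo (λ j → reverse (h m (suc j))) (suc n))
    (sym (map-applyUpTo suc (λ j → reverse (h m j)) (suc n))))

  -- The part of numerator (3 + k) after h_kᴿ h_{k+1}ᴿ and before its last letter.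
  middle : ℕ → Word m
  middle k =
    if m ≡ᵇ 2 then [] else
    if 3 + k <ᵇ m then letter m (3 + k) ∷ hᴿ⟨_⋯_⟩ m 0 k
    else hᴿ⟨_⋯_⟩ m (3 + k ∸ m) k

  -- Applying φᴿ raises every index by one. The extra letter 3 + k becomes 4 + k followed by 0 =
  -- h₀ᴿ; when 3 + k = m - 1 it becomes h₀ᴿ alone, which is the change from the formula for n < m to
  -- the one for n ≥ m.
  middle-step : ∀ k → φᴿ (middle k) ≡ middle (suc k)
  middle-step k with m ≡ᵇ 2
  ... | true = refl
  ... | false with 3 + k <ᵇ m | <ᵇ-reflects-< (3 + k) m | 4 + k <ᵇ m | <ᵇ-reflects-< (4 + k) m
  ...   | false | ofⁿ ge | true  | ofʸ lt = contradiction (<-trans (n<1+n _) lt) ge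
  ...   | false | ofⁿ ge | false | _      = trans (φᴿ-hᴿ (λ j → (3 + k ∸ m) + j) (suc k ∸ (3 + k ∸ m)))
            (cong (λ a → hᴿ⟨_⋯_⟩ m a (suc k)) (sym (+-∸-assoc 1 (≮⇒≥ ge))))
  ...   | true  | ofʸ lt | b     | r      = trans
            (cong₂ _++_ (reverse-φ b r) (φᴿ-hᴿ (λ j → j) (suc k))) (tail b)
    where
    new : Bool → Word m
    new true  = letter m (4 + k) ∷ 𝟎 ∷ []
    new false = [ 𝟎 ]

    toℕ-3+k : toℕ (letter m (3 + k)) ≡ 3 + k
    toℕ-3+k = trans (toℕ-letter m (3 + k)) (m<n⇒m%n≡m {{nonTrivial⇒nonZero m}} lt)

    reverse-φ : ∀ b → Reflects (4 + k < m) b → reverse (φ m (letter m (3 + k))) ≡ new b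
    reverse-φ b r with φ-view (letter m (3 + k)) | b | r
    ... | inner _ eq   | true  | _      = trans (cong reverse eq) (cong (λ a → a ∷ 𝟎 ∷ []) (σ-letter (3 + k)))
    ... | inner lt′ _  | false | ofⁿ ge = contradiction (subst (λ n → suc n < m) toℕ-3+k lt′) ge
    ... | last eq _ _  | true  | ofʸ lt′ = contradiction (trans (cong suc (sym toℕ-3+k)) eq) (<⇒≢ lt′)
    ... | last _ eq _  | false | _      = cong reverse eq

    tail : ∀ b → new b ++ hᴿ⟨_⋯_⟩ m 1 (suc k) ≡
      (if b then letter m (4 + k) ∷ hᴿ⟨_⋯_⟩ m 0 (suc k) else hᴿ⟨_⋯_⟩ m (4 + k ∸ m) (suc k))
    tail true  = cong (letter m (4 + k) ∷_) (hᴿ-first k)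
    -- Since 4 + k ≤ m, the truncated difference is 0 and the product starts with h₀ᴿ.
    tail false = trans (hᴿ-first k)
      (cong (λ a → hᴿ⟨_⋯_⟩ m a (suc k)) (sym (m≤n⇒m∸n≡0 lt)))

  numerator-init : ℕ → Word m
  numerator-init k = reverse (h m k) ++ reverse (h m (suc k)) ++ middle k

  numerator-∷ʳ : ∀ k → numerator m (3 + k) ≡ numerator-init k ∷ʳ letter m (suc k)
  numerator-∷ʳ k = trans eq (sym (trans (++-assoc (reverse (h m k)) _ _)
      (cong (reverse (h m k) ++_) (++-assoc (reverse (h m (suc k))) _ _))))
    where
    eq : numerator m (3 + k) ≡ reverse (h m k) ++ reverse (h m (suc k)) ++ middle k ∷ʳ letter m (suc k)
    eq with m ≡ᵇ 2 | 3 + k <ᵇ m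
    ... | true  | _     = refl
    ... | false | true  = refl
    ... | false | false = refl

  numerator-init-step : ∀ k → φ* m (numerator-init k) ++ [ 𝟎 ] ≡ 𝟎 ∷ numerator-init (suc k)
  numerator-init-step k = trans (φ*-φᴿ (numerator-init k)) (cong (𝟎 ∷_) (begin
    φᴿ (numerator-init k)
      ≡⟨ concatMap-++ _ (reverse (h m k)) _ ⟩
    φᴿ (reverse (h m k)) ++ φᴿ (reverse (h m (suc k)) ++ middle k)
      ≡⟨ cong₂ _++_ (φᴿ-reverse (h m k)) (concatMap-++ _ (reverse (h m (suc k))) _) ⟩
    reverse (h m (suc k)) ++ φᴿ (reverse (h m (suc k))) ++ φᴿ (middle k)
      ≡⟨ cong (reverse (h m (suc k)) ++_) (cong₂ _++_ (φᴿ-reverse (h m (suc k))) (middle-step k)) ⟩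
    numerator-init (suc k) ∎))
    where open ≡-Reasoning

  z-last : ∀ k → ∃[ x ] z m (3 + k) ≡ x ∷ʳ letter m (suc k)
  z-last k with u , eq ← h-last m k = _ , ∷-injectiveʳ (begin
    letter m k ∷ z m (3 + k)                     ≡⟨ z-quotient m k ⟨
    numerator m (3 + k)                          ≡⟨ numerator-∷ʳ k ⟩
    numerator-init k ∷ʳ letter m (suc k)         ≡⟨ cong (λ y → (y ++ reverse (h m (suc k)) ++ middle k) ∷ʳ letter m (suc k))
                                                      (trans (cong reverse eq) (reverse-++ u [ letter m k ])) ⟩
    letter m k ∷ (reverse u ++ reverse (h m (suc k)) ++ middle k) ∷ʳ letter m (suc k) ∎)
    where open ≡-Reasoning

  -- The next numerator preceded by 𝟎 is T of the present one. Its first letters 0 σ(a), where a is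
  -- the letter k, are φ(a) followed by the carry of a; cancelling φ(a), the image of the letter
  -- removed from the present numerator, leaves the carry.
  carry-z : ∀ k → carry (letter m k) ++ z m (4 + k) ≡ T (z m (3 + k))
  carry-z k with x , eq ← z-last k = ++-cancelˡ (φ m (letter m k)) _ _ (begin
    φ m (letter m k) ++ carry (letter m k) ++ z m (4 + k)     ≡⟨ ++-assoc (φ m (letter m k)) _ _ ⟨
    (φ m (letter m k) ++ carry (letter m k)) ++ z m (4 + k)   ≡⟨ cong (_++ z m (4 + k)) (φ-carry (letter m k)) ⟩
    𝟎 ∷ σ (letter m k) ∷ z m (4 + k)                          ≡⟨ cong (λ a → 𝟎 ∷ a ∷ z m (4 + k)) (σ-letter k) ⟩
    𝟎 ∷ letter m (suc k) ∷ z m (4 + k)                        ≡⟨ cong (𝟎 ∷_) (z-quotient m (suc k)) ⟨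
    𝟎 ∷ numerator m (4 + k)                                   ≡⟨ cong (𝟎 ∷_) (numerator-∷ʳ (suc k)) ⟩
    𝟎 ∷ numerator-init (suc k) ∷ʳ letter m (2 + k)            ≡⟨ cong (_∷ʳ letter m (2 + k)) (numerator-init-step k) ⟨
    (φ* m (numerator-init k) ++ [ 𝟎 ]) ∷ʳ letter m (2 + k)    ≡⟨ ++-assoc (φ* m (numerator-init k)) _ _ ⟩
    φ* m (numerator-init k) ++ 𝟎 ∷ letter m (2 + k) ∷ []      ≡⟨ cong (λ a → φ* m (numerator-init k) ++ 𝟎 ∷ a ∷ []) (σ-letter (suc k)) ⟨
    φ* m (numerator-init k) ++ 𝟎 ∷ σ (letter m (suc k)) ∷ []  ≡⟨ T-∷ʳ (numerator-init k) (letter m (suc k)) ⟨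
    T (numerator-init k ∷ʳ letter m (suc k))                  ≡⟨ cong T (numerator-∷ʳ k) ⟨
    T (numerator m (3 + k))                                   ≡⟨ cong T (z-quotient m k) ⟩
    T (letter m k ∷ z m (3 + k))                              ≡⟨ cong (λ y → T (letter m k ∷ y)) eq ⟩
    T ([ letter m k ] ++ x ∷ʳ letter m (suc k))               ≡⟨ T-++-∷ʳ [ letter m k ] x (letter m (suc k)) ⟩
    (φ m (letter m k) ++ []) ++ T (x ∷ʳ letter m (suc k))     ≡⟨ cong (_++ T (x ∷ʳ letter m (suc k))) (++-identityʳ _) ⟩
    φ m (letter m k) ++ T (x ∷ʳ letter m (suc k))             ≡⟨ cong (λ y → φ m (letter m k) ++ T y) eq ⟨
    φ m (letter m k) ++ T (z m (3 + k))                       ∎)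
    where open ≡-Reasoning

-- The start of the induction.

z₂-shape : ∀ m .{{_ : NonTrivial m}} → ∃[ x ] z m 2 ≡ letter m 0 ∷ x ∷ʳ letter m 0
z₂-shape m with m ≡ᵇ 2
... | true  = [] , refl
... | false = [ letter m 2 ] , refl

-- The cases m = 2, m = 3 and m > 3 fall under the three different formulas for the numerator at n =
-- 3.
z₃-T : ∀ m .{{_ : NonTrivial m}} → letter m 0 ∷ z m 3 ≡ T m (z m 2)
z₃-T 0 = contradiction (1<m 0) λ ()
z₃-T 1 = contradiction (1<m 1) λ { (s≤s ()) }
z₃-T 2 = refl
z₃-T 3 = refl
z₃-T (suc (suc (suc (suc m)))) = refl

z₀z₁z₂ : ∀ m .{{_ : NonTrivial m}} → h m 1 ++ z m 2 ≡ φ* m (h m 1) ++ [ letter m 0 ]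
z₀z₁z₂ 0 = contradiction (1<m 0) λ ()
z₀z₁z₂ 1 = contradiction (1<m 1) λ { (s≤s ()) }
z₀z₁z₂ 2 = refl
z₀z₁z₂ (suc (suc (suc m))) = refl

-- The word hω starts with 0100 if m = 2 and with 01020 otherwise. The border of z₂ is the letter 0,
-- so B is empty, and g = 0 already occurs as the first letter of hω.
Good-z₂ : ∀ m .{{_ : NonTrivial m}} → Good m (letter m 0 ∷ letter m 1 ∷ []) (z m 2)
Good-z₂ 0 = contradiction (1<m 0) λ ()
Good-z₂ 1 = contradiction (1<m 1) λ { (s≤s ()) }
Good-z₂ 2 = record
  { B = [] ; a = letter 2 0 ; v = [ letter 2 0 ] ; g = [ letter 2 0 ] ; w = []
  ; z-end = refl ; v-nonempty = z<s ; g-nonempty = z<s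
  ; z-here = here
  ; b-here = ⊑-prefix 2 (h 2 2) here
  ; r-here = ⊑-prefix 2 (h 2 2) here
  ; r-earlier = h⊑ 2 0
  ; w<p = z<s
  -- The letter 1 at position 1 of hω excludes both shorter u.
  ; first = λ where
      []          (prefixᵒ q) → contradiction (q (suc zero)) λ ()
      (_ ∷ [])    (prefixᵒ q) → contradiction (q (suc zero)) λ ()
      (_ ∷ _ ∷ _) _           → s≤s (s≤s z≤n)
  ; returns = λ where
      []              _ → inj₁ z≤n
      (_ ∷ [])        _ → inj₁ (s≤s z≤n)
      (_ ∷ _ ∷ [])    _ → inj₁ (s≤s (s≤s z≤n))
      (_ ∷ _ ∷ _ ∷ u) _ → inj₂ (s≤s (s≤s (s≤s (length-++-≤ʳ [ letter 2 0 ] {u}))))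
  }
  where
  here = ⊑-φ*-𝟎 2 (h 2 1) (h⊑ 2 1)
Good-z₂ m@(suc (suc (suc _))) = record
  { B = [] ; a = letter m 0 ; v = letter m 0 ∷ letter m 2 ∷ [] ; g = [ letter m 0 ] ; w = []
  ; z-end = refl ; v-nonempty = z<s ; g-nonempty = z<s
  ; z-here = here
  ; b-here = ⊑-prefix m (letter m 0 ∷ letter m 1 ∷ letter m 0 ∷ []) here
  ; r-here = ⊑-prefix m (letter m 0 ∷ letter m 1 ∷ letter m 0 ∷ []) here
  ; r-earlier = h⊑ m 0
  ; w<p = z<s
  ; first = λ where
      []          (prefixᵒ q) → contradiction (q (suc zero)) λ ()
      (_ ∷ [])    (prefixᵒ q) → contradiction (q (suc zero)) λ ()
      (_ ∷ _ ∷ _) _           → s≤s (s≤s z≤n)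
  ; returns = λ where
      []                  _           → inj₁ z≤n
      (_ ∷ [])            _           → inj₁ (s≤s z≤n)
      (_ ∷ _ ∷ [])        _           → inj₁ (s≤s (s≤s z≤n))
      -- Position 3 of hω holds the letter 2.
      (_ ∷ _ ∷ _ ∷ [])    (prefixᵒ q) → contradiction (q (suc (suc (suc zero)))) λ ()
      (_ ∷ _ ∷ _ ∷ _ ∷ u) _           → inj₂ (s≤s (s≤s (s≤s (s≤s (length-++-≤ʳ [ letter m 0 ] {u})))))
  }
  where
  here = ⊑-φ*-𝟎 m (h m 1) (h⊑ m 1)

-- The induction and the factorization.

module _ (m : ℕ) .{{_ : NonTrivial m}} where

  private
    𝟎 : Fin m
    𝟎 = letter m 0

    P : ℕ → Word m
    P = partialProduct (z m)

  -- The word e for the passage from z₂₊ₖ to z₃₊ₖ. At k = 0 it is 𝟎 for every m, also when the carry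
  -- of the last letter 1 of p₂ is empty.
  pending : ℕ → Word m
  pending zero    = [ 𝟎 ]
  pending (suc k) = carry m (letter m k)

  pending-z : ∀ k → pending k ++ z m (3 + k) ≡ T m (z m (2 + k))
  pending-z zero    = z₃-T m
  pending-z (suc k) = carry-z m k

  -- Consecutive letters k and k + 1 are not both 𝟎, so this prevents two consecutive pending words
  -- from being non-empty.
  pending-cases : ∀ k → pending k ≡ [] ⊎ (pending k ≡ [ 𝟎 ] × letter m k ≡ 𝟎)
  pending-cases zero    = inj₂ (refl , refl)
  pending-cases (suc k) with φ-view m (letter m k)
  ... | inner _ _   = inj₁ refl
  ... | last _ _ σ0 = inj₂ (refl , trans (sym (σ-letter m k)) σ0)

  z-∷ʳ : ∀ k → ∃[ x ] z m (2 + k) ≡ x ∷ʳ letter m k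
  z-∷ʳ zero    = let x , eq = z₂-shape m in 𝟎 ∷ x , eq
  z-∷ʳ (suc k) = z-last m k

  -- The pending word of one step completes z₃₊ₖ to T(z₂₊ₖ), which is φ*(z₂₊ₖ) followed by the carry
  -- of its last letter; this carry is the next pending word.
  P-step : ∀ k → P (3 + k) ≡ φ* m (P (2 + k)) ++ pending k
  P-step zero = begin
    P 3                                    ≡⟨ partialProduct-suc (z m) 2 ⟩
    P 2 ++ z m 2                           ≡⟨ cong (_++ z m 2) h₁ ⟨
    h m 1 ++ z m 2                         ≡⟨ z₀z₁z₂ m ⟩
    φ* m (h m 1) ++ [ 𝟎 ]                  ≡⟨ cong (λ y → φ* m y ++ [ 𝟎 ]) h₁ ⟩
    φ* m (P 2) ++ [ 𝟎 ]                    ∎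
    where
    open ≡-Reasoning
    h₁ : h m 1 ≡ P 2
    h₁ = trans (++-identityʳ _) (φ-0 m)
  P-step (suc k) with x , eq ← z-∷ʳ k = begin
    P (4 + k)                                          ≡⟨ partialProduct-suc (z m) (3 + k) ⟩
    P (3 + k) ++ z m (3 + k)                           ≡⟨ cong (_++ z m (3 + k)) (P-step k) ⟩
    (φ* m (P (2 + k)) ++ pending k) ++ z m (3 + k)     ≡⟨ ++-assoc (φ* m (P (2 + k))) _ _ ⟩
    φ* m (P (2 + k)) ++ pending k ++ z m (3 + k)       ≡⟨ cong (φ* m (P (2 + k)) ++_) (pending-z k) ⟩
    φ* m (P (2 + k)) ++ T m (z m (2 + k))              ≡⟨ cong (λ y → φ* m (P (2 + k)) ++ T m y) eq ⟩
    φ* m (P (2 + k)) ++ T m (x ∷ʳ a)                   ≡⟨ cong (φ* m (P (2 + k)) ++_) (T-carry m x a) ⟩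
    φ* m (P (2 + k)) ++ φ* m (x ∷ʳ a) ++ carry m a     ≡⟨ ++-assoc (φ* m (P (2 + k))) _ _ ⟨
    (φ* m (P (2 + k)) ++ φ* m (x ∷ʳ a)) ++ carry m a   ≡⟨ cong (_++ carry m a) (φ*-++ m (P (2 + k)) (x ∷ʳ a)) ⟨
    φ* m (P (2 + k) ++ x ∷ʳ a) ++ carry m a            ≡⟨ cong (λ y → φ* m (P (2 + k) ++ y) ++ carry m a) eq ⟨
    φ* m (P (2 + k) ++ z m (2 + k)) ++ carry m a       ≡⟨ cong (λ y → φ* m y ++ carry m a) (partialProduct-suc (z m) (2 + k)) ⟨
    φ* m (P (3 + k)) ++ carry m a                      ∎
    where
    open ≡-Reasoning
    a = letter m k

  -- When a 𝟎 is pending after the first step, nothing was pending one step before, so z₃₊ₖ is all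
  -- of T(z₂₊ₖ) and starts with 𝟎.
  z-shift : ∀ k → Shift m (pending k) (z m (2 + k))
  z-shift zero    = inj₂ (refl , _ , proj₂ (z₂-shape m))
  z-shift (suc k) with pending-cases (suc k)
  ... | inj₁ e≡ = inj₁ e≡
  ... | inj₂ (e≡ , k+1≡0) with pending-cases k
  ...   | inj₂ (_ , k≡0) = contradiction
            (trans (cong (σ m) (sym k≡0)) (trans (σ-letter m k) k+1≡0)) (σ𝟎≢𝟎 m)
  ...   | inj₁ e′≡
    with x , eq ← z-∷ʳ k
    with c , t , eqc ← ∷ʳ-∷ m x (letter m k)
    with s , eqs ← T-σ m c t
    = inj₂ (e≡ , _ , trans (trans (cong (_++ z m (3 + k)) (sym e′≡)) (pending-z k))
        (trans (cong (T m) (trans eq eqc)) eqs))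

  Good-z : ∀ k → Good m (P (2 + k)) (z m (2 + k))
  Good-z zero    = Good-z₂ m
  Good-z (suc k) = subst (λ p → Good m p (z m (3 + k))) (sym (P-step k))
    (Good-step m (z-shift k) (pending-z k) (Good-z k))

  P⊑ : ∀ n → P n ⊑ hω m
  P⊑ zero          = λ ()
  P⊑ (suc zero)    = h⊑hω m 0
  P⊑ (suc (suc k)) = _⊑hω.prefixᵒ⁻¹ (⊑-prefix m (P (2 + k)) (Good.z-here (Good-z k)))

  singleton-candidate : ∀ p a → p ++ [ a ] ⊑ hω m → (∀ u → _⊑hω m (u ++ [ a ]) → length p ≤ length u) →
                        Candidate (hω m) p [ a ]
  singleton-candidate p a q first =
    ⊑-drop (hω m) p q , ((λ ()) , inj₁ refl) , first⇒once m p [ a ] (prefixᵒ q) first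

  z-candidate : ∀ n → Candidate (hω m) (P n) (z m n)
  z-candidate zero          = singleton-candidate [] 𝟎 (P⊑ 1) λ _ _ → z≤n
  z-candidate (suc zero)    = singleton-candidate [ 𝟎 ] (letter m 1) (P⊑ 2) λ where
    []      (prefixᵒ q) → contradiction (trans (σ-letter m 0) (q zero)) (σ𝟎≢𝟎 m)
    (_ ∷ _) _           → s≤s z≤n
  z-candidate (suc (suc k)) = Good-candidate m (Good-z k)

  nonempty : ∀ {x : Word m} → x ≢ [] → 0 < length x
  nonempty {[]}    x≢ = contradiction refl x≢
  nonempty {_ ∷ _} _  = z<s

  z-nonempty : ∀ n → 0 < length (z m n)
  z-nonempty n = let _ , (z≢[] , _) , _ = z-candidate n in nonempty z≢[]

  z-shortest : ∀ n x → Candidate (hω m) (P n) x → length (z m n) ≤ length x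
  z-shortest zero          x (_ , (x≢[] , _) , _) = nonempty x≢[]
  z-shortest (suc zero)    x (_ , (x≢[] , _) , _) = nonempty x≢[]
  z-shortest (suc (suc k)) x                      = Good-shortest m (Good-z k) x

  n≤length-P : ∀ n → n ≤ length (P n)
  n≤length-P zero    = z≤n
  n≤length-P (suc n) = begin
    suc n                                  ≡⟨ +-comm 1 n ⟩
    n + 1                                  ≤⟨ +-mono-≤ (n≤length-P n) (z-nonempty n) ⟩
    length (P n) + length (z m n)          ≡⟨ length-++ (P n) ⟨
    length (P n ++ z m n)                  ≡⟨ cong length (partialProduct-suc (z m) n) ⟨
    length (P (suc n))                     ∎
    where open ≤-Reasoning

theorem42 : (m : ℕ) .{{_ : NonTrivial m}} → IsClosedZFactorization (hω m) (z m)
theorem42 m = record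
  { product   = P⊑ m , λ N → N , n≤length-P m N
  ; candidate = z-candidate m
  ; shortest  = z-shortest m
  }
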